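{- Let $n\in\mathbb{N}$ and let $\varphi$ be a formula of $\mathbf{CPN}_n$ (built only from propositional letters, the constants $\perp_c$, $\perp_{(n)}$, $\top_{(n)}$, the negations $\neg_c$ and $\to_{(n)}$). Regard $\varphi$ as a formula of $\mathbf{CPN}_{n+1}$ by reading every chain over $[n]$ as a chain over $[n+1]$ (so $\perp_{(n)}$ becomes $\perp_{\{1,\dots,n\}}$ and $\neg_{(n)}$ becomes the weak negation $\neg_{\{1,\dots,n\}}$ of $\mathbf{CPN}_{n+1}$), replacing $\to_{(n)}$ by $\to_{(n+1)}$ and $\top_{(n)}$ by $\top_{(n+1)}$. If $\vdash_{(n+1)}\varphi$, then $\vdash_{(n)}\varphi$.
   Context: For each $m\ge 1$, write $[m]=\{1,\dots,m\}$. Chains: a chain over $[m]$ is a finite sequence of distinct elements of $[m]$; chains with the same length and the same symbols are identified, so a chain is effectively a subset of $[m]$; $\epsilon$ is the empty chain and $(m)$ the chain of all symbols of $[m]$. For chains $c,d$: the coconcatenation $c\otimes d$ is the chain of symbols occurring in exactly one of $c,d$; $d$ is a subchain of $c$ if every symbol of $d$ is a symbol of $c$. Language of $\mathbf{CPN}_m$: a countable set of propositional letters (the same for all $m$); constants $\perp_c$ for each chain $c$ over $[m]$ with $1\le|c|\le m-1$, and constants $\perp_{(m)}$ and $\top_{(m)}$; a unary connective $\neg_c$ for each nonempty chain $c$ over $[m]$; a binary connective $\to_{(m)}$. Formulas are built as usual. Conventions: $\neg_\epsilon\varphi:=\varphi$, $\perp_\epsilon:=\top_{(m)}$, and $\perp_c$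 for $c=(m)$ means $\perp_{(m)}$. Abbreviations: $\varphi\wedge_{(m)}\psi:=\neg_{(m)}(\varphi\to_{(m)}\neg_{(m)}\psi)$, $\varphi\leftrightarrow_{(m)}\psi:=(\varphi\to_{(m)}\psi)\wedge_{(m)}(\psi\to_{(m)}\varphi)$. Axioms of $\mathbf{CPN}_m$, for all formulas $\varphi,\psi,\chi$ and all nonempty chains $c_k,c_r$ over $[m]$: (A1) $\varphi\to_{(m)}(\psi\to_{(m)}\varphi)$; (A2) $(\varphi\to_{(m)}(\psi\to_{(m)}\chi))\to_{(m)}((\varphi\to_{(m)}\psi)\to_{(m)}(\varphi\to_{(m)}\chi))$; (A3) $(\neg_{(m)}\psi\to_{(m)}\neg_{(m)}\varphi)\to_{(m)}((\neg_{(m)}\psi\to_{(m)}\varphi)\to_{(m)}\psi)$; (A4) $\varphi\to_{(m)}(\perp_{c_k}\to_{(m)}\neg_{c_k}\varphi)$; (A5) $\neg_{c_k}\neg_{c_r}\varphi\leftrightarrow_{(m)}\neg_{c_k\otimes c_r}\varphi$; (A6) $\neg_{c_k}\perp_{c_r}\leftrightarrow_{(m)}\perp_{c_k\otimes c_r}$; (A7) $\perp_{c_k}\to_{(m)}\perp_{c_r}$, whenever $c_r$ is a subchain of $c_k$. The only rule is modus ponens for $\to_{(m)}$; $\vdash_{(m)}\varphi$ means $\varphi$ has a derivation from these axioms by modus ponens. -}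

module Defs where

open import Data.Bool using (_xor_)
open import Data.Fin using (Fin; zero; suc; inject₁)
open import Data.Fin.Subset using (Subset; Nonempty; outside; _∈_; _⊆_; ⊤)
open import Data.Fin.Subset.Properties using (nonempty?)
open import Data.Irrelevant using ([_])
open import Data.Nat using (ℕ; suc; NonZero)
open import Data.Product using (_,_)
open import Data.Refinement using (Refinement-syntax; value; map)
  renaming (_,_ to _,ᵣ_)
open import Data.Vec using (_∷_; zipWith; _∷ʳ_; here; there)
open import Relation.Nullary using (yes; no)

-- Chains with the same symbols are identified, so a chain over {1,…,m} is a
-- subset of Fin m.  Here i : Fin m stands for the symbol i + 1.
Chain : ℕ → Set
Chain = Subset

-- The nonemptiness proof is irrelevant, so that a nonempty chain is
-- determined by its symbols.
Chain⁺ : ℕ → Set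
Chain⁺ m = [ c ∈ Chain m ∣ Nonempty c ]

infixl 7 _⊗_

_⊗_ : ∀ {m} → Chain m → Chain m → Chain m
_⊗_ = zipWith _xor_

full : ∀ m → Chain m
full m = ⊤

infix  9 ⊥[_] ⊥⟨_⟩
infixr 8 ¬[_]_ ¬⟨_⟩_ ~_
infixr 6 _∧_
infixr 5 _⇒_
infix  4 _⇔_

-- For m ≥ 1 the chains c with 1 ≤ |c| ≤ m ∸ 1 together with the full chain
-- are exactly the nonempty chains, so ⊥[_] covers all the constants ⊥_c and
-- ⊥_(m).
data Formula (m : ℕ) : Set where
  letter : ℕ → Formula m
  verum  : Formula m
  ⊥[_]   : Chain⁺ m → Formula m
  ¬[_]_  : Chain⁺ m → Formula m → Formula m
  _⇒_    : Formula m → Formula m → Formula m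

-- ⊥⟨_⟩ and ¬⟨_⟩_ extend ⊥[_] and ¬[_]_ to all chains by the conventions
-- ⊥_ε := ⊤_(m) and ¬_ε φ := φ.
⊥⟨_⟩ : ∀ {m} → Chain m → Formula m
⊥⟨ c ⟩ with nonempty? c
... | yes c≢ε = ⊥[ c ,ᵣ [ c≢ε ] ]
... | no  _   = verum

¬⟨_⟩_ : ∀ {m} → Chain m → Formula m → Formula m
¬⟨ c ⟩ φ with nonempty? c
... | yes c≢ε = ¬[ c ,ᵣ [ c≢ε ] ] φ
... | no  _   = φ

-- ¬_(m); for m ≥ 1 the full chain is nonempty, so this is a primitive negation.
~_ : ∀ {m} → Formula m → Formula m
~_ {m} φ = ¬⟨ full m ⟩ φ

_∧_ : ∀ {m} → Formula m → Formula m → Formula m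
φ ∧ ψ = ~ (φ ⇒ ~ ψ)

_⇔_ : ∀ {m} → Formula m → Formula m → Formula m
φ ⇔ ψ = (φ ⇒ ψ) ∧ (ψ ⇒ φ)

infix 3 ⊢[_]_

data ⊢[_]_ (m : ℕ) .{{_ : NonZero m}} : Formula m → Set where
  A1 : ∀ φ ψ → ⊢[ m ] φ ⇒ (ψ ⇒ φ)
  A2 : ∀ φ ψ χ → ⊢[ m ] (φ ⇒ (ψ ⇒ χ)) ⇒ ((φ ⇒ ψ) ⇒ (φ ⇒ χ))
  A3 : ∀ φ ψ → ⊢[ m ] (~ ψ ⇒ ~ φ) ⇒ ((~ ψ ⇒ φ) ⇒ ψ)
  A4 : ∀ φ (c : Chain⁺ m) → ⊢[ m ] φ ⇒ (⊥[ c ] ⇒ ¬[ c ] φ)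
  A5 : ∀ φ (c d : Chain⁺ m) →
       ⊢[ m ] ¬[ c ] ¬[ d ] φ ⇔ ¬⟨ value c ⊗ value d ⟩ φ
  A6 : ∀ (c d : Chain⁺ m) →
       ⊢[ m ] ¬[ c ] ⊥[ d ] ⇔ ⊥⟨ value c ⊗ value d ⟩
  A7 : ∀ (c d : Chain⁺ m) → value d ⊆ value c → ⊢[ m ] ⊥[ c ] ⇒ ⊥[ d ]
  MP : ∀ {φ ψ} → ⊢[ m ] φ → ⊢[ m ] φ ⇒ ψ → ⊢[ m ] ψ

-- A chain over {1,…,n} read over {1,…,n+1}: the new symbol n+1 (the last
-- position) does not occur in it.
liftChain : ∀ {n} → Chain n → Chain (suc n)
liftChain c = c ∷ʳ outside

∈-liftChain : ∀ {n} {i : Fin n} {c : Chain n} → i ∈ c → inject₁ i ∈ liftChain c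
∈-liftChain {i = zero}  {_ ∷ _} here        = here
∈-liftChain {i = suc _} {_ ∷ _} (there i∈c) = there (∈-liftChain i∈c)

liftChain⁺ : ∀ {n} → Chain⁺ n → Chain⁺ (suc n)
liftChain⁺ = map liftChain (λ (i , i∈c) → inject₁ i , ∈-liftChain i∈c)

lift : ∀ {n} → Formula n → Formula (suc n)
lift (letter p)  = letter p
lift verum       = verum
lift ⊥[ c ]      = ⊥[ liftChain⁺ c ]
lift (¬[ c ] φ)  = ¬[ liftChain⁺ c ] lift φ
lift (φ ⇒ ψ)     = lift φ ⇒ lift ψ

{-# OPTIONS --safe #-}

-- Deleting the symbol n+1 from every chain maps the formulas of CPN_{n+1} back
-- to those of CPN_n and is a left inverse of lift.  On chains the deletion is
-- monotone, commutes with ⊗ and sends the full chain to the full chain, so it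
-- sends axioms to axioms, except that a nonempty chain may become empty.  It
-- remains to derive (A4)–(A7) in CPN_n for arbitrary chains, under the
-- conventions for ε; the only case with content is ¬_c ⊤ ⇔ ⊥_c.
module Submission where

open import Data.Bool using (true; false)
open import Data.Bool.Properties using (xor-identityˡ; xor-identityʳ)
open import Data.Fin using (Fin; zero; suc; inject₁)
open import Data.Fin.Subset using (Empty; Nonempty; _∈_; _⊆_)
open import Data.Fin.Subset.Properties using (nonempty?; Empty-unique)
open import Data.Irrelevant using ([_])
open import Data.Nat using (ℕ; suc; NonZero)
open import Data.Product using (_,_)
open import Data.Refinement using (value)
  renaming (_,_ to _,ᵣ_)
open import Data.Vec using (_∷_; []; here; there; init)
open import Data.Vec.Properties
  using (init-∷ʳ; zipWith-identityˡ; zipWith-identityʳ)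
open import Function using (case_of_)
open import Relation.Binary.PropositionalEquality
  using (_≡_; refl; sym; trans; cong; cong₂; subst; subst₂)
open import Relation.Nullary using (yes; no; contradiction)
open import Relation.Nullary.Negation using (contradiction-irr)
open import Defs

private
  variable
    n : ℕ

Empty-⊗ˡ : {c : Chain n} → Empty c → ∀ d → c ⊗ d ≡ d
Empty-⊗ˡ c≡ε d rewrite Empty-unique c≡ε = zipWith-identityˡ xor-identityˡ d

Empty-⊗ʳ : {d : Chain n} → Empty d → ∀ c → c ⊗ d ≡ c
Empty-⊗ʳ d≡ε c rewrite Empty-unique d≡ε = zipWith-identityʳ xor-identityʳ c

Empty-⊗-self : (c : Chain n) → Empty (c ⊗ c)
Empty-⊗-self (false ∷ c) (suc i , there p) = Empty-⊗-self c (i , p)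
Empty-⊗-self (true  ∷ c) (suc i , there p) = Empty-⊗-self c (i , p)

full-nonempty : .{{_ : NonZero n}} → Nonempty (full n)
full-nonempty {suc _} = zero , here

init-⊗ : (c d : Chain (suc n)) → init (c ⊗ d) ≡ init c ⊗ init d
init-⊗ {0}     (_ ∷ []) (_ ∷ []) = refl
init-⊗ {suc _} (x ∷ c)  (y ∷ d)  = cong (_ ∷_) (init-⊗ c d)

init-full : ∀ n → init (full (suc n)) ≡ full n
init-full 0       = refl
init-full (suc n) = cong (_ ∷_) (init-full n)

∈-init⁻ : {i : Fin n} (c : Chain (suc n)) → i ∈ init c → inject₁ i ∈ c
∈-init⁻ {suc _} {zero}  (_ ∷ _) here      = here
∈-init⁻ {suc _} {suc _} (_ ∷ c) (there p) = there (∈-init⁻ c p)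

∈-init⁺ : {i : Fin n} (c : Chain (suc n)) → inject₁ i ∈ c → i ∈ init c
∈-init⁺ {suc _} {zero}  (_ ∷ _) here      = here
∈-init⁺ {suc _} {suc _} (_ ∷ c) (there p) = there (∈-init⁺ c p)

init-⊆ : {c d : Chain (suc n)} → c ⊆ d → init c ⊆ init d
init-⊆ {c = c} {d} c⊆d i∈c = ∈-init⁺ d (c⊆d (∈-init⁻ c i∈c))

init-Empty : {c : Chain (suc n)} → Empty c → Empty (init c)
init-Empty {c = c} c≡ε (i , i∈c) = c≡ε (inject₁ i , ∈-init⁻ c i∈c)

⊥⟨⟩-Empty : {c : Chain n} → Empty c → ⊥⟨ c ⟩ ≡ verum
⊥⟨⟩-Empty {c = c} c≡ε with nonempty? c
... | yes c≢ε = contradiction c≢ε c≡ε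
... | no  _   = refl

¬⟨⟩-Empty : {c : Chain n} → Empty c → ∀ φ → ¬⟨ c ⟩ φ ≡ φ
¬⟨⟩-Empty {c = c} c≡ε φ with nonempty? c
... | yes c≢ε = contradiction c≢ε c≡ε
... | no  _   = refl

-- Lifting and then deleting gives back a nonempty chain, where the convention must return the
-- primitive constant. The witness found by `nonempty?` need not be the stored one, but witnesses
-- are irrelevant.
⊥⟨⟩-value : (c : Chain⁺ n) → ⊥⟨ value c ⟩ ≡ ⊥[ c ]
⊥⟨⟩-value (c ,ᵣ [ p ]) with nonempty? c
... | yes _   = refl
... | no  c≡ε = contradiction-irr p c≡ε

¬⟨⟩-value : (c : Chain⁺ n) (φ : Formula n) → ¬⟨ value c ⟩ φ ≡ ¬[ c ] φ
¬⟨⟩-value (c ,ᵣ [ p ]) φ with nonempty? c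
... | yes _   = refl
... | no  c≡ε = contradiction-irr p c≡ε

-- The chain with the single symbol n+1 is the one nonempty chain that `init` empties; its constant
-- becomes `verum` and its negation disappears.
restrict : Formula (suc n) → Formula n
restrict (letter p) = letter p
restrict verum      = verum
restrict ⊥[ c ]     = ⊥⟨ init (value c) ⟩
restrict (¬[ c ] φ) = ¬⟨ init (value c) ⟩ restrict φ
restrict (φ ⇒ ψ)    = restrict φ ⇒ restrict ψ

restrict-lift : (φ : Formula n) → restrict (lift φ) ≡ φ
restrict-lift (letter p) = refl
restrict-lift verum      = refl
restrict-lift ⊥[ c ]     =
  trans (cong ⊥⟨_⟩ (init-∷ʳ _ (value c))) (⊥⟨⟩-value c)
restrict-lift (¬[ c ] φ) =
  trans (cong₂ ¬⟨_⟩_ (init-∷ʳ _ (value c)) (restrict-lift φ)) (¬⟨⟩-value c φ)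
restrict-lift (φ ⇒ ψ)    = cong₂ _⇒_ (restrict-lift φ) (restrict-lift ψ)

-- Meant for (A6), where `c ⊗ d` can be empty before the deletion; it then stays empty, and both
-- sides are `verum`.
restrict-⊥⟨⟩ : (c : Chain (suc n)) → restrict ⊥⟨ c ⟩ ≡ ⊥⟨ init c ⟩
restrict-⊥⟨⟩ c with nonempty? c
... | yes _   = refl
... | no  c≡ε = sym (⊥⟨⟩-Empty (init-Empty c≡ε))

restrict-¬⟨⟩ : (c : Chain (suc n)) (φ : Formula (suc n)) →
               restrict (¬⟨ c ⟩ φ) ≡ ¬⟨ init c ⟩ restrict φ
restrict-¬⟨⟩ c φ with nonempty? c
... | yes _   = refl
... | no  c≡ε = sym (¬⟨⟩-Empty (init-Empty c≡ε) _)

restrict-~ : (φ : Formula (suc n)) → restrict (~ φ) ≡ ~ restrict φ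
restrict-~ {n} φ =
  trans (restrict-¬⟨⟩ (full (suc n)) φ)
        (cong (λ c → ¬⟨ c ⟩ restrict φ) (init-full n))

restrict-∧ : (φ ψ : Formula (suc n)) → restrict (φ ∧ ψ) ≡ restrict φ ∧ restrict ψ
restrict-∧ φ ψ =
  trans (restrict-~ (φ ⇒ ~ ψ))
        (cong (λ χ → ~ (restrict φ ⇒ χ)) (restrict-~ ψ))

module _ {m : ℕ} .{{_ : NonZero m}} where

  weaken : ∀ {φ ψ} → ⊢[ m ] ψ → ⊢[ m ] φ ⇒ ψ
  weaken p = MP p (A1 _ _)

  apply : ∀ {φ ψ χ} → ⊢[ m ] φ ⇒ (ψ ⇒ χ) → ⊢[ m ] φ ⇒ ψ → ⊢[ m ] φ ⇒ χ
  apply p q = MP q (MP p (A2 _ _ _))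

  compose : ∀ {φ ψ χ} → ⊢[ m ] φ ⇒ ψ → ⊢[ m ] ψ ⇒ χ → ⊢[ m ] φ ⇒ χ
  compose p q = apply (weaken q) p

  ⇒-refl : ∀ φ → ⊢[ m ] φ ⇒ φ
  ⇒-refl φ = apply (A1 φ (φ ⇒ φ)) (A1 φ φ)

  contrapose⁻ : ∀ φ ψ → ⊢[ m ] ~ ψ ⇒ ~ φ → ⊢[ m ] φ ⇒ ψ
  contrapose⁻ φ ψ p = compose (A1 φ (~ ψ)) (MP p (A3 φ ψ))

  reductio : ∀ φ ψ → ⊢[ m ] ~ ψ → ⊢[ m ] ~ φ ⇒ ψ → ⊢[ m ] φ
  reductio φ ψ p q = MP q (MP (weaken p) (A3 ψ φ))

  ~~-elim : ∀ φ → ⊢[ m ] ~ ~ φ ⇒ φ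
  ~~-elim φ =
    apply (compose (A1 (~ ~ φ) (~ φ)) (A3 (~ φ) φ)) (weaken (⇒-refl (~ φ)))

  -- (A1) turns `~ φ` and `φ` into `~ ψ ⇒ ~ φ` and `~ ψ ⇒ φ`, from which (A3) concludes `ψ`; (A2)
  -- carries this out under the premise `φ`.
  explosion : ∀ φ ψ → ⊢[ m ] ~ φ ⇒ (φ ⇒ ψ)
  explosion φ ψ =
    apply (compose (compose (A1 (~ φ) (~ ψ)) (A3 φ ψ))
                   (compose (A1 _ φ) (A2 φ (~ ψ ⇒ φ) ψ)))
          (weaken (A1 φ (~ ψ)))

  ∧-intro : ∀ φ ψ → ⊢[ m ] φ → ⊢[ m ] ψ → ⊢[ m ] φ ∧ ψ
  ∧-intro φ ψ p q =
    -- Under `~ ~ (φ ⇒ ~ ψ)`, double negation elimination and `φ` give `~ ψ`, against `ψ`; (A3) then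
    -- yields the conjunction.
    MP (weaken q) (MP (apply (~~-elim (φ ⇒ ~ ψ)) (weaken p)) (A3 ψ (~ (φ ⇒ ~ ψ))))

  ∧-elimˡ : ∀ φ ψ → ⊢[ m ] φ ∧ ψ → ⊢[ m ] φ
  ∧-elimˡ φ ψ p = reductio φ (φ ⇒ ~ ψ) p (explosion φ (~ ψ))

  ∧-elimʳ : ∀ φ ψ → ⊢[ m ] φ ∧ ψ → ⊢[ m ] ψ
  ∧-elimʳ φ ψ p = reductio ψ (φ ⇒ ~ ψ) p (A1 (~ ψ) φ)

  ⇔-refl : ∀ φ → ⊢[ m ] φ ⇔ φ
  ⇔-refl φ = ∧-intro _ _ (⇒-refl φ) (⇒-refl φ)

  ⇔-to : ∀ φ ψ → ⊢[ m ] φ ⇔ ψ → ⊢[ m ] φ ⇒ ψ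
  ⇔-to φ ψ = ∧-elimˡ (φ ⇒ ψ) (ψ ⇒ φ)

  ⇔-from : ∀ φ ψ → ⊢[ m ] φ ⇔ ψ → ⊢[ m ] ψ ⇒ φ
  ⇔-from φ ψ = ∧-elimʳ (φ ⇒ ψ) (ψ ⇒ φ)

  A4⟨⟩ : ∀ φ (c : Chain m) → ⊢[ m ] φ ⇒ (⊥⟨ c ⟩ ⇒ ¬⟨ c ⟩ φ)
  A4⟨⟩ φ c with nonempty? c
  ... | yes c≢ε = A4 φ (c ,ᵣ [ c≢ε ])
  ... | no  _   = A1 φ verum

  -- If `c` or `d` is empty, both sides are the same formula.
  A5⟨⟩ : ∀ φ (c d : Chain m) → ⊢[ m ] ¬⟨ c ⟩ ¬⟨ d ⟩ φ ⇔ ¬⟨ c ⊗ d ⟩ φ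
  A5⟨⟩ φ c d with nonempty? c
  ... | no c≡ε rewrite Empty-⊗ˡ c≡ε d = ⇔-refl _
  ... | yes c≢ε with nonempty? d
  ...   | no d≡ε rewrite Empty-⊗ʳ d≡ε c | ¬⟨⟩-value (c ,ᵣ [ c≢ε ]) φ = ⇔-refl _
  ...   | yes d≢ε = A5 φ (c ,ᵣ [ c≢ε ]) (d ,ᵣ [ d≢ε ])

  -- The case of empty `d` is postponed: it rests on `¬⊤⇔⊥`, whose proof uses the present case.
  A6⟨⟩-Nonempty : ∀ (c d : Chain m) → Nonempty d →
                  ⊢[ m ] ¬⟨ c ⟩ ⊥⟨ d ⟩ ⇔ ⊥⟨ c ⊗ d ⟩
  A6⟨⟩-Nonempty c d d≢ε with nonempty? c
  ... | no c≡ε rewrite Empty-⊗ˡ c≡ε d = ⇔-refl _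
  ... | yes c≢ε with nonempty? d
  ...   | no d≡ε  = contradiction d≢ε d≡ε
  ...   | yes d≢ε = A6 (c ,ᵣ [ c≢ε ]) (d ,ᵣ [ d≢ε ])

  -- (A4) for the full chain, applied to its own constant, shows that this constant implies its
  -- negation; by (A3) it is then refuted.
  ⊢~⊥ : ⊢[ m ] ~ ⊥⟨ full m ⟩
  ⊢~⊥ = MP ~~⊥⇒⊥ (MP (compose ~~⊥⇒⊥ ⊥⇒~⊥) (A3 ⊥⟨ full m ⟩ (~ ⊥⟨ full m ⟩)))
    where
    ~~⊥⇒⊥ = ~~-elim ⊥⟨ full m ⟩
    ⊥⇒~⊥  = apply (A4⟨⟩ ⊥⟨ full m ⟩ (full m)) (⇒-refl ⊥⟨ full m ⟩)

  -- No axiom asserts `verum` outright. Since `full m ⊗ full m` is empty, (A6) turns `~ ⊥⟨ full m ⟩`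
  -- into it.
  ⊢verum : ⊢[ m ] verum
  ⊢verum = subst (⊢[ m ]_) (⊥⟨⟩-Empty (Empty-⊗-self (full m)))
    (MP ⊢~⊥ (⇔-to _ _ (A6⟨⟩-Nonempty (full m) (full m) full-nonempty)))

  -- For the forward direction, (A4) for the complement c′ of c gives
  -- ¬_c′ ⊤ from ⊥_c′, that is, ~ ¬_c ⊤ from ~ ⊥_c.
  ¬⊤⇔⊥ : ∀ (c : Chain m) → Nonempty c → ⊢[ m ] ¬⟨ c ⟩ verum ⇔ ⊥⟨ c ⟩
  ¬⊤⇔⊥ c c≢ε =
    ∧-intro _ _ (contrapose⁻ _ _ ~⊥⇒~¬⊤) (MP ⊢verum (A4⟨⟩ verum c))
    where
    c′ = full m ⊗ c

    ~⊥⇒~¬⊤ : ⊢[ m ] ~ ⊥⟨ c ⟩ ⇒ ~ ¬⟨ c ⟩ verum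
    ~⊥⇒~¬⊤ =
      compose (⇔-to _ _ (A6⟨⟩-Nonempty (full m) c c≢ε))
      (compose (MP ⊢verum (A4⟨⟩ verum c′))
               (⇔-from _ _ (A5⟨⟩ verum (full m) c)))

  A6⟨⟩ : ∀ (c d : Chain m) → ⊢[ m ] ¬⟨ c ⟩ ⊥⟨ d ⟩ ⇔ ⊥⟨ c ⊗ d ⟩
  A6⟨⟩ c d = case nonempty? c , nonempty? d of λ where
    (_       , yes d≢ε) → A6⟨⟩-Nonempty c d d≢ε
    (yes c≢ε , no d≡ε)  → subst₂ (λ φ e → ⊢[ m ] ¬⟨ c ⟩ φ ⇔ ⊥⟨ e ⟩)
      (sym (⊥⟨⟩-Empty d≡ε)) (sym (Empty-⊗ʳ d≡ε c)) (¬⊤⇔⊥ c c≢ε)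
    (no c≡ε  , no _)    → subst₂ (λ φ e → ⊢[ m ] φ ⇔ ⊥⟨ e ⟩)
      (sym (¬⟨⟩-Empty c≡ε _)) (sym (Empty-⊗ˡ c≡ε d)) (⇔-refl _)

  -- An empty `c` forces `d` to be empty, and then the conclusion is the provable `verum`.
  A7⟨⟩ : ∀ {c d : Chain m} → d ⊆ c → ⊢[ m ] ⊥⟨ c ⟩ ⇒ ⊥⟨ d ⟩
  A7⟨⟩ {c} {d} d⊆c with nonempty? c | nonempty? d
  ... | yes c≢ε | yes d≢ε       = A7 (c ,ᵣ [ c≢ε ]) (d ,ᵣ [ d≢ε ]) d⊆c
  ... | no  c≡ε | yes (i , i∈d) = contradiction (i , d⊆c i∈d) c≡ε
  ... | _       | no  _         = weaken ⊢verum

restrict-⇔ : (φ ψ : Formula (suc n)) →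
             restrict (φ ⇔ ψ) ≡ (restrict φ ⇔ restrict ψ)
restrict-⇔ φ ψ = restrict-∧ (φ ⇒ ψ) (ψ ⇒ φ)

-- `restrict` commutes with `⇒` by definition, so modus ponens carries over directly. Only (A3),
-- (A5) and (A6), which involve `~`, `⇔` or `⊗`, must first be rewritten.
restrict-sound : .{{_ : NonZero n}} {φ : Formula (suc n)} →
                 ⊢[ suc n ] φ → ⊢[ n ] restrict φ
restrict-sound (A1 φ ψ)   = A1 _ _
restrict-sound (A2 φ ψ χ) = A2 _ _ _
restrict-sound (A3 φ ψ) rewrite restrict-~ φ | restrict-~ ψ = A3 _ _
restrict-sound (A4 φ c)   = A4⟨⟩ _ _
restrict-sound (A5 φ c d)
  rewrite restrict-⇔ (¬[ c ] ¬[ d ] φ) (¬⟨ value c ⊗ value d ⟩ φ)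
        | restrict-¬⟨⟩ (value c ⊗ value d) φ
        | init-⊗ (value c) (value d) = A5⟨⟩ _ (init (value c)) (init (value d))
restrict-sound (A6 c d)
  rewrite restrict-⇔ (¬[ c ] ⊥[ d ]) ⊥⟨ value c ⊗ value d ⟩
        | restrict-⊥⟨⟩ (value c ⊗ value d)
        | init-⊗ (value c) (value d) = A6⟨⟩ (init (value c)) (init (value d))
restrict-sound (A7 c d d⊆c) = A7⟨⟩ (init-⊆ d⊆c)
restrict-sound (MP p q)     = MP (restrict-sound p) (restrict-sound q)

mainTheorem16 : (n : ℕ) .{{_ : NonZero n}} (φ : Formula n) → ⊢[ suc n ] lift φ → ⊢[ n ] φ
mainTheorem16 n φ p = subst (⊢[ n ]_) (restrict-lift φ) (restrict-sound p)
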